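{- Let $G_1$ and $G_2$ be two vertex-disjoint simple connected graphs with $|V(G_1)|=n_1$, $|V(G_2)|=n_2$, $|E(G_1)|=m_1$, $|E(G_2)|=m_2$. Then the edge R-join $G_1\underline{\vee}_R G_2$ satisfies \[ F(G_1\underline{\vee}_R G_2)=8F(G_1)+F(G_2)+3m_1M_1(G_2)+6m_1^{2}m_2+m_1(n_2+2)^3+n_2m_1^{3}. \]
   Context: For a simple graph $G$ and $v\in V(G)$, $d_G(v)$ is the degree of $v$. The first Zagreb index is $M_1(G)=\sum_{v\in V(G)}d_G(v)^2$ and the F-index is $F(G)=\sum_{v\in V(G)}d_G(v)^3$. The graph $R(G)$ is obtained from $G$ by inserting a new vertex into each edge of $G$ and joining each new vertex to the two end vertices of the corresponding edge (so the original edges of $G$ are kept); let $I(G)$ denote the set of these new vertices, so $V(R(G))=V(G)\cup I(G)$. The edge R-join $G_1\underline{\vee}_R G_2$ is the graph obtained from $R(G_1)$ and $G_2$ (taken vertex-disjoint) by joining each vertex of $I(G_1)$ to every vertex of $G_2$ by an edge. -}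

module Defs where

open import Data.Empty using (⊥)
open import Data.Fin using (Fin)
open import Data.Fin.Properties using () renaming (_≟_ to _≟ᶠ_)
open import Data.List using (List; []; _∷_; _++_; map; filter; length; lookup; allFin)
open import Data.List.Membership.Propositional using (_∈_)
open import Data.List.Membership.Propositional.Properties
  using (∈-map⁺; ∈-map⁻; ∈-++⁺ˡ; ∈-++⁺ʳ; ∈-allFin)
open import Data.List.Relation.Unary.Unique.Propositional using (Unique)
import Data.List.Relation.Unary.Unique.Propositional.Properties as Unique
open import Data.Nat using (ℕ; _^_)
open import Data.Nat.ListAction using (sum)
open import Data.Product using (_×_; _,_; proj₁; proj₂)
open import Data.Sum using (_⊎_; inj₁; inj₂)
open import Data.Sum.Properties using (≡-dec; inj₁-injective; inj₂-injective)
open import Data.Unit using (⊤; tt)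
open import Relation.Binary.Construct.Closure.ReflexiveTransitive using (Star)
open import Relation.Binary.Definitions
  using (Symmetric; DecidableEquality) renaming (Decidable to Decidable₂)
open import Relation.Binary.PropositionalEquality using (_≡_; refl)
open import Relation.Nullary using (¬_; Dec; yes; no)
open import Relation.Nullary.Decidable using (_⊎-dec_)

record Finite (A : Set) : Set where
  infix 4 _≟_
  field
    elements : List A
    unique   : Unique elements
    complete : ∀ x → x ∈ elements
    _≟_      : DecidableEquality A


finFinite : ∀ n → Finite (Fin n)
finFinite n = record
  { elements = allFin n
  ; unique   = Unique.allFin⁺ n
  ; complete = ∈-allFin
  ; _≟_      = _≟ᶠ_
  }

_⊎-finite_ : ∀ {A B} → Finite A → Finite B → Finite (A ⊎ B)
_⊎-finite_ {A} {B} FA FB = record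
  { elements = map inj₁ FA.elements ++ map inj₂ FB.elements
  ; unique   = Unique.++⁺ (Unique.map⁺ inj₁-injective FA.unique)
                          (Unique.map⁺ inj₂-injective FB.unique)
                          disjoint
  ; complete = complete
  ; _≟_      = ≡-dec FA._≟_ FB._≟_
  }
  where
  module FA = Finite FA
  module FB = Finite FB

  disjoint : ∀ {z} → ¬ (z ∈ map inj₁ FA.elements × z ∈ map inj₂ FB.elements)
  disjoint (p , q) with ∈-map⁻ inj₁ p | ∈-map⁻ inj₂ q
  ... | _ , _ , refl | _ , _ , ()

  complete : ∀ z → z ∈ map inj₁ FA.elements ++ map inj₂ FB.elements
  complete (inj₁ a) = ∈-++⁺ˡ (∈-map⁺ inj₁ (FA.complete a))
  complete (inj₂ b) = ∈-++⁺ʳ (map inj₁ FA.elements) (∈-map⁺ inj₂ (FB.complete b))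

-- Each two-element sublist once: on a duplicate-free list, this represents
-- every unordered pair of distinct entries by exactly one ordered pair.
pairs : ∀ {A : Set} → List A → List (A × A)
pairs []       = []
pairs (x ∷ xs) = map (x ,_) xs ++ pairs xs

record SimpleGraph : Set₁ where
  infix 4 _~_ _~?_
  field
    V       : Set
    finite  : Finite V
    _~_     : V → V → Set
    _~?_    : Decidable₂ _~_
    ~-sym   : Symmetric _~_
    ~-irrefl : ∀ {v} → ¬ (v ~ v)

  open Finite finite public using (_≟_) renaming (elements to vertices)

  edges : List (V × V)
  edges = filter (λ e → proj₁ e ~? proj₂ e) (pairs vertices)

  order : ℕ
  order = length vertices

  size : ℕ
  size = length edges

  E : Set
  E = Fin size

  _endOf_ : V → E → Set
  v endOf e = v ≡ proj₁ (lookup edges e) ⊎ v ≡ proj₂ (lookup edges e)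

  _endOf?_ : ∀ v e → Dec (v endOf e)
  v endOf? e = (v ≟ proj₁ (lookup edges e)) ⊎-dec (v ≟ proj₂ (lookup edges e))

  degree : V → ℕ
  degree v = length (filter (v ~?_) vertices)

  Connected : Set
  Connected = V × (∀ u v → Star _~_ u v)

open SimpleGraph using (V; vertices; degree)

M₁ : SimpleGraph → ℕ
M₁ G = sum (map (λ v → degree G v ^ 2) (vertices G))

F : SimpleGraph → ℕ
F G = sum (map (λ v → degree G v ^ 3) (vertices G))

-- inj₂ e is the vertex inserted into the edge e, so I(G) is the right summand.
R : SimpleGraph → SimpleGraph
R G = record
  { V        = G.V ⊎ G.E
  ; finite   = G.finite ⊎-finite finFinite G.size
  ; _~_      = _~_
  ; _~?_     = _~?_
  ; ~-sym    = λ {x} {y} → ~-sym x y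
  ; ~-irrefl = λ {x} → ~-irrefl x
  }
  where
  module G = SimpleGraph G

  _~_ : G.V ⊎ G.E → G.V ⊎ G.E → Set
  inj₁ u ~ inj₁ v = u G.~ v
  inj₁ u ~ inj₂ e = u G.endOf e
  inj₂ e ~ inj₁ v = v G.endOf e
  inj₂ _ ~ inj₂ _ = ⊥

  _~?_ : Decidable₂ _~_
  inj₁ u ~? inj₁ v = u G.~? v
  inj₁ u ~? inj₂ e = u G.endOf? e
  inj₂ e ~? inj₁ v = v G.endOf? e
  inj₂ _ ~? inj₂ _ = no λ ()

  ~-sym : ∀ x y → x ~ y → y ~ x
  ~-sym (inj₁ _) (inj₁ _) p = G.~-sym p
  ~-sym (inj₁ _) (inj₂ _) p = p
  ~-sym (inj₂ _) (inj₁ _) p = p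

  ~-irrefl : ∀ x → ¬ (x ~ x)
  ~-irrefl (inj₁ _) = G.~-irrefl

infixl 6 _∨ᴿ_

-- The sum type makes the two vertex sets disjoint.
_∨ᴿ_ : SimpleGraph → SimpleGraph → SimpleGraph
G₁ ∨ᴿ G₂ = record
  { V        = H.V ⊎ K.V
  ; finite   = H.finite ⊎-finite K.finite
  ; _~_      = _~_
  ; _~?_     = _~?_
  ; ~-sym    = λ {x} {y} → ~-sym x y
  ; ~-irrefl = λ {x} → ~-irrefl x
  }
  where
  module H = SimpleGraph (R G₁)
  module K = SimpleGraph G₂

  _~_ : H.V ⊎ K.V → H.V ⊎ K.V → Set
  inj₁ x        ~ inj₁ y        = x H.~ y
  inj₂ u        ~ inj₂ v        = u K.~ v
  inj₁ (inj₁ _) ~ inj₂ _        = ⊥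
  inj₁ (inj₂ _) ~ inj₂ _        = ⊤
  inj₂ _        ~ inj₁ (inj₁ _) = ⊥
  inj₂ _        ~ inj₁ (inj₂ _) = ⊤

  _~?_ : Decidable₂ _~_
  inj₁ x        ~? inj₁ y        = x H.~? y
  inj₂ u        ~? inj₂ v        = u K.~? v
  inj₁ (inj₁ _) ~? inj₂ _        = no λ ()
  inj₁ (inj₂ _) ~? inj₂ _        = yes tt
  inj₂ _        ~? inj₁ (inj₁ _) = no λ ()
  inj₂ _        ~? inj₁ (inj₂ _) = yes tt

  ~-sym : ∀ x y → x ~ y → y ~ x
  ~-sym (inj₁ x)        (inj₁ y)        p = H.~-sym {x} {y} p
  ~-sym (inj₂ _)        (inj₂ _)        p = K.~-sym p
  ~-sym (inj₁ (inj₂ _)) (inj₂ _)        _ = tt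
  ~-sym (inj₂ _)        (inj₁ (inj₂ _)) _ = tt

  ~-irrefl : ∀ x → ¬ (x ~ x)
  ~-irrefl (inj₁ x) = H.~-irrefl {x}
  ~-irrefl (inj₂ _) = K.~-irrefl

-- In G₁ ∨ᴿ G₂ an old vertex of G₁ has twice its degree in G₁, since R adds one
-- neighbour per incident edge; an inserted vertex has degree n₂ + 2; a vertex w
-- of G₂ has degree m₁ + d(w). Expanding Σ (m₁ + d(w))³ gives the terms in
-- F(G₂) and M₁(G₂), and the handshake identity Σ d(w) = 2 m₂ gives the rest.
module Submission where

open import Defs
open import Data.List using (List; []; _∷_; _++_; map; filter; length; lookup; allFin)
open import Data.List.Membership.Propositional using (_∈_)
open import Data.List.Membership.Propositional.Properties using (∈-lookup)
open import Data.List.Properties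
  using (length-++; length-tabulate; map-cong; map-++; map-∘;
         map-tabulate; tabulate-lookup; filter-++; filter-≐; filter-all; filter-none;
         filter-accept; filter-reject)
open import Data.List.Relation.Unary.All as All using (All; []; _∷_)
open import Data.List.Relation.Unary.All.Properties using (all-filter)
open import Data.List.Relation.Unary.AllPairs using ([]; _∷_)
open import Data.List.Relation.Unary.Any using (here; there)
open import Data.List.Relation.Unary.Unique.Propositional using (Unique)
open import Data.Nat using (ℕ; suc; _+_; _*_; _^_)
open import Data.Nat.ListAction using (sum)
open import Data.Nat.ListAction.Properties using (sum-++)
open import Data.Nat.Properties
  using (+-comm; +-identityʳ; +-suc; +-commutativeSemigroup; *-comm; *-zeroʳ)
open import Algebra.Properties.CommutativeSemigroup +-commutativeSemigroup using (x∙yz≈y∙xz)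
open import Data.Nat.Solver using (module +-*-Solver)
open import Data.Product using (_×_; _,_; proj₁; proj₂)
open import Data.Sum using (_⊎_; inj₁; inj₂; [_,_]′)
open import Data.Unit using (tt)
open import Function using (_∘_; id)
open import Relation.Binary.Definitions
  using (Symmetric; DecidableEquality) renaming (Decidable to Decidable₂)
open import Relation.Binary.PropositionalEquality
  using (_≡_; _≢_; refl; sym; trans; cong; cong₂; subst; module ≡-Reasoning)
open import Relation.Nullary using (¬_; Dec; yes; no; contradiction)
open import Relation.Nullary.Decidable using (_×-dec_; _⊎-dec_)
open import Relation.Unary using (Decidable; _≐_; ∁)

open ≡-Reasoning
open +-*-Solver using (solve; _:=_; _:+_; _:*_; _:^_; con)

private
  variable
    A B : Set

-- Counting the list entries with a decidable property.

count : {P : A → Set} → Decidable P → List A → ℕ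
count P? xs = length (filter P? xs)

count-++ : {P : A → Set} (P? : Decidable P) (xs ys : List A) →
           count P? (xs ++ ys) ≡ count P? xs + count P? ys
count-++ P? xs ys = trans (cong length (filter-++ P? xs ys)) (length-++ (filter P? xs))

count-map : {P : A → Set} (P? : Decidable P) (f : B → A) (xs : List B) →
            count P? (map f xs) ≡ count (P? ∘ f) xs
count-map P? f []       = refl
count-map P? f (x ∷ xs) with P? (f x)
... | yes _ = cong suc (count-map P? f xs)
... | no  _ = count-map P? f xs

count-⊎ : {P : A ⊎ B → Set} (P? : Decidable P) (xs : List A) (ys : List B) →
          count P? (map inj₁ xs ++ map inj₂ ys) ≡ count (P? ∘ inj₁) xs + count (P? ∘ inj₂) ys
count-⊎ P? xs ys = trans (count-++ P? (map inj₁ xs) (map inj₂ ys))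
                         (cong₂ _+_ (count-map P? inj₁ xs) (count-map P? inj₂ ys))

count-≐ : {P Q : A → Set} (P? : Decidable P) (Q? : Decidable Q) → P ≐ Q →
          ∀ xs → count P? xs ≡ count Q? xs
count-≐ P? Q? P≐Q xs = cong length (filter-≐ P? Q? P≐Q xs)

count-all : {P : A → Set} (P? : Decidable P) → (∀ x → P x) → ∀ xs → count P? xs ≡ length xs
count-all P? p xs = cong length (filter-all P? (All.universal p xs))

count-none : {P : A → Set} (P? : Decidable P) {xs : List A} → All (∁ P) xs → count P? xs ≡ 0
count-none P? ¬p = cong length (filter-none P? ¬p)

-- Since `edges` is a filtered list, this trades a count over edges for one over all of
-- `pairs vertices`, where induction on the vertex list is possible.
count-filter : {P Q : A → Set} (P? : Decidable P) (Q? : Decidable Q) (xs : List A) →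
               count Q? (filter P? xs) ≡ count (λ x → P? x ×-dec Q? x) xs
count-filter P? Q? []       = refl
count-filter P? Q? (x ∷ xs) with P? x
... | no  _ = count-filter P? Q? xs
... | yes _ with Q? x
...   | yes _ = cong suc (count-filter P? Q? xs)
...   | no  _ = count-filter P? Q? xs

count-disjoint : {P Q : A → Set} (P? : Decidable P) (Q? : Decidable Q) →
                 (∀ {x} → P x → ¬ Q x) →
                 ∀ xs → count (λ x → P? x ⊎-dec Q? x) xs ≡ count P? xs + count Q? xs
count-disjoint P? Q? P∩Q=∅ []       = refl
count-disjoint P? Q? P∩Q=∅ (x ∷ xs) with P? x | Q? x
... | yes p | yes q = contradiction q (P∩Q=∅ p)
... | yes _ | no  _ = cong suc (count-disjoint P? Q? P∩Q=∅ xs)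
... | no  _ | no  _ = count-disjoint P? Q? P∩Q=∅ xs
... | no  _ | yes _ = trans (cong suc (count-disjoint P? Q? P∩Q=∅ xs))
                          (sym (+-suc (count P? xs) (count Q? xs)))

-- Membership provides one occurrence of `a`; by duplicate-freeness every entry before it and every
-- entry after it differs from `a`.
count-unique : (_≟_ : DecidableEquality A) {a : A} {xs : List A} →
               Unique xs → a ∈ xs → count (_≟ a) xs ≡ 1
count-unique _≟_ (a∉xs ∷ _) (here refl) =
  trans (cong length (filter-accept (_≟ _) refl))
        (cong suc (count-none (_≟ _) (All.map (λ a≢x x≡a → a≢x (sym x≡a)) a∉xs)))
count-unique _≟_ (x∉xs ∷ xs!) (there a∈xs) =
  trans (cong length (filter-reject (_≟ _) (All.lookup x∉xs a∈xs)))
        (count-unique _≟_ xs! a∈xs)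

-- Inserted vertices are indexed by positions in `edges`. Reading off all positions in order gives
-- back the list, so counts over indices become counts over pairs.
count-allFin-lookup : {P : A → Set} (P? : Decidable P) (xs : List A) →
                      count (P? ∘ lookup xs) (allFin (length xs)) ≡ count P? xs
count-allFin-lookup P? xs = begin
  count (P? ∘ lookup xs) (allFin (length xs))
    ≡⟨ count-map P? (lookup xs) (allFin (length xs)) ⟨
  count P? (map (lookup xs) (allFin (length xs)))
    ≡⟨ cong (count P?) (trans (map-tabulate id (lookup xs)) (tabulate-lookup xs)) ⟩
  count P? xs ∎

-- Sums over lists, double counting and sums of cubes.

sum-const : (c : ℕ) (xs : List A) → sum (map (λ _ → c) xs) ≡ length xs * c
sum-const c []       = refl
sum-const c (_ ∷ xs) = cong (c +_) (sum-const c xs)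

module _ {_~_ : A → B → Set} (_~?_ : ∀ x y → Dec (x ~ y)) where

  -- A new row `x` in the 0-1 table of the relation raises the total of column `y` by one exactly
  -- when `x ~ y`, and these increments add up to the row total of `x`.
  sum-count-∷ : ∀ x xs ys →
    sum (map (λ y → count (_~? y) (x ∷ xs)) ys) ≡
    count (x ~?_) ys + sum (map (λ y → count (_~? y) xs) ys)
  sum-count-∷ x xs []       = refl
  sum-count-∷ x xs (y ∷ ys) with x ~? y
  ... | yes _ = cong suc (trans (cong (count (_~? y) xs +_) (sum-count-∷ x xs ys))
                                (x∙yz≈y∙xz (count (_~? y) xs) (count (x ~?_) ys) _))
  ... | no  _ = trans (cong (count (_~? y) xs +_) (sum-count-∷ x xs ys))
                      (x∙yz≈y∙xz (count (_~? y) xs) (count (x ~?_) ys) _)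

  -- Row totals and column totals of the same 0-1 table; the induction adds one row at a time.
  double-count : ∀ xs ys → sum (map (λ x → count (x ~?_) ys) xs) ≡
                           sum (map (λ y → count (_~? y) xs) ys)
  double-count []       ys = sym (trans (sum-const 0 ys) (*-zeroʳ (length ys)))
  double-count (x ∷ xs) ys = trans (cong (count (x ~?_) ys +_) (double-count xs ys))
                                   (sym (sum-count-∷ x xs ys))

sum-⊎ : (f : A ⊎ B → ℕ) (xs : List A) (ys : List B) →
        sum (map f (map inj₁ xs ++ map inj₂ ys)) ≡
        sum (map (f ∘ inj₁) xs) + sum (map (f ∘ inj₂) ys)
sum-⊎ f xs ys = begin
  sum (map f (map inj₁ xs ++ map inj₂ ys))
    ≡⟨ cong sum (map-++ f (map inj₁ xs) (map inj₂ ys)) ⟩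
  sum (map f (map inj₁ xs) ++ map f (map inj₂ ys))
    ≡⟨ sum-++ (map f (map inj₁ xs)) (map f (map inj₂ ys)) ⟩
  sum (map f (map inj₁ xs)) + sum (map f (map inj₂ ys))
    ≡⟨ cong₂ (λ us vs → sum us + sum vs) (sym (map-∘ xs)) (sym (map-∘ ys)) ⟩
  sum (map (f ∘ inj₁) xs) + sum (map (f ∘ inj₂) ys) ∎

sum-double-cube : (d : A → ℕ) (xs : List A) →
  sum (map (λ x → (2 * d x) ^ 3) xs) ≡ 8 * sum (map (λ x → d x ^ 3) xs)
sum-double-cube d []       = refl
sum-double-cube d (x ∷ xs) = trans (cong ((2 * d x) ^ 3 +_) (sum-double-cube d xs))
  (solve 2 (λ a s → (con 2 :* a) :^ 3 :+ con 8 :* s := con 8 :* (a :^ 3 :+ s)) refl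
    (d x) (sum (map (λ x → d x ^ 3) xs)))

-- Binomial theorem at each entry; the constant term `m ^ 3` is collected once per entry, hence the
-- factor `length xs`.
sum-shifted-cube : (m : ℕ) (d : A → ℕ) (xs : List A) →
  sum (map (λ x → (m + d x) ^ 3) xs) ≡
  sum (map (λ x → d x ^ 3) xs) + 3 * m * sum (map (λ x → d x ^ 2) xs)
    + 3 * m ^ 2 * sum (map d xs) + length xs * m ^ 3
sum-shifted-cube m d []       =
  solve 1 (λ m → con 0 := con 0 :+ con 3 :* m :* con 0 :+ con 3 :* m :^ 2 :* con 0
                            :+ con 0 :* m :^ 3) refl m
sum-shifted-cube m d (x ∷ xs) = trans (cong ((m + d x) ^ 3 +_) (sum-shifted-cube m d xs))
  (solve 6 (λ m a s₃ s₂ s₁ n →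
      (m :+ a) :^ 3 :+ (s₃ :+ con 3 :* m :* s₂ :+ con 3 :* m :^ 2 :* s₁ :+ n :* m :^ 3)
      := a :^ 3 :+ s₃ :+ con 3 :* m :* (a :^ 2 :+ s₂) :+ con 3 :* m :^ 2 :* (a :+ s₁)
         :+ (con 1 :+ n) :* m :^ 3) refl
    m (d x) (sum (map (λ x → d x ^ 3) xs)) (sum (map (λ x → d x ^ 2) xs))
    (sum (map d xs)) (length xs))

-- Edges at a vertex, counted in a list of pairs.

module _ (_≟_ : DecidableEquality A) {_~_ : A → A → Set} (_~?_ : Decidable₂ _~_) where

  -- Stated for pairs rather than edge indices; composition with `lookup edges` gives back
  -- `_endOf?_`.
  incident? : ∀ u (e : A × A) → Dec (u ≡ proj₁ e ⊎ u ≡ proj₂ e)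
  incident? u e = (u ≟ proj₁ e) ⊎-dec (u ≟ proj₂ e)

  -- Adjacency belongs to the predicate instead of filtering the list, so that the list being
  -- counted, `pairs xs`, unfolds along with `xs`.
  edgeAt? : ∀ u (e : A × A) →
            Dec (proj₁ e ~ proj₂ e × (u ≡ proj₁ e ⊎ u ≡ proj₂ e))
  edgeAt? u e = (proj₁ e ~? proj₂ e) ×-dec incident? u e

  count-edgeAt-∷ : ∀ u x xs → count (edgeAt? u) (pairs (x ∷ xs)) ≡
    count (λ y → edgeAt? u (x , y)) xs + count (edgeAt? u) (pairs xs)
  count-edgeAt-∷ u x xs = trans (count-++ (edgeAt? u) (map (x ,_) xs) (pairs xs))
    (cong (_+ count (edgeAt? u) (pairs xs)) (count-map (edgeAt? u) (x ,_) xs))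

  -- Both components of an entry of `pairs xs` come from `xs`, so neither can be `u`.
  count-edgeAt-∉ : ∀ {u xs} → All (u ≢_) xs → count (edgeAt? u) (pairs xs) ≡ 0
  count-edgeAt-∉ [] = refl
  count-edgeAt-∉ {u} {x ∷ xs} (u≢x ∷ u∉xs) = trans (count-edgeAt-∷ u x xs)
    (cong₂ _+_
      (count-none (λ y → edgeAt? u (x , y)) (All.map (λ u≢y → [ u≢x , u≢y ]′ ∘ proj₂) u∉xs))
      (count-edgeAt-∉ u∉xs))

  module _ (~-sym : Symmetric _~_) (~-irrefl : ∀ {v} → ¬ (v ~ v)) where

    -- Each unordered pair is listed once, so the pairs containing `u` match the other entries of
    -- `xs`, and adjacency selects the same ones on both sides. The induction follows the position
    -- of `u`: at the head, its pairs form exactly the first row; further on, the first row has a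
    -- single pair containing `u`.
    count-edgeAt : ∀ {u xs} → Unique xs → u ∈ xs →
                   count (edgeAt? u) (pairs xs) ≡ count (u ~?_) xs
    count-edgeAt {u} {_ ∷ xs} (u∉xs ∷ _) (here refl) = begin
      count (edgeAt? u) (pairs (u ∷ xs))
        ≡⟨ count-edgeAt-∷ u u xs ⟩
      count (λ y → edgeAt? u (u , y)) xs + count (edgeAt? u) (pairs xs)
        ≡⟨ cong₂ _+_
             -- In the row of `u` the first component is already the required end, so only `u ~ y`
             -- is left to decide.
             (count-≐ (λ y → edgeAt? u (u , y)) (u ~?_) (proj₁ , (_, inj₁ refl)) xs)
             (count-edgeAt-∉ u∉xs) ⟩
      count (u ~?_) xs + 0
        ≡⟨ +-identityʳ _ ⟩
      count (u ~?_) xs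
        -- The head `u` is not its own neighbour, so restoring it leaves the count unchanged.
        ≡⟨ cong length (filter-reject (u ~?_) ~-irrefl) ⟨
      count (u ~?_) (u ∷ xs) ∎
    count-edgeAt {u} {x ∷ xs} (x∉xs ∷ xs!) (there u∈xs) = trans (count-edgeAt-∷ u x xs) step
      where
      x≢u : x ≢ u
      x≢u = All.lookup x∉xs u∈xs

      step : count (λ y → edgeAt? u (x , y)) xs + count (edgeAt? u) (pairs xs) ≡
             count (u ~?_) (x ∷ xs)
      -- The row of `x` contributes one or zero, just as the head `x` does among the neighbours of
      -- `u`.
      step with u ~? x
      ... | yes u~x = cong₂ _+_
        (trans
          -- As `x` differs from `u`, the pair `(x , y)` contains `u` only if `y ≡ u`, and `u`
          -- occurs once in `xs`.
          (count-≐ (λ y → edgeAt? u (x , y)) (_≟ u)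
            ( (λ { (_ , inj₁ u≡x) → contradiction (sym u≡x) x≢u
                 ; (_ , inj₂ u≡y) → sym u≡y })
            , (λ { refl → ~-sym u~x , inj₂ refl }))
            xs)
          (count-unique _≟_ xs! u∈xs))
        (count-edgeAt xs! u∈xs)
      ... | no u≁x = cong₂ _+_
        (count-none (λ y → edgeAt? u (x , y))
          (All.universal
            (λ { y (_   , inj₁ u≡x)  → x≢u (sym u≡x)
               ; y (x~y , inj₂ refl) → u≁x (~-sym x~y) })
            xs))
        (count-edgeAt xs! u∈xs)

-- Incidence between vertices and edges, and the handshake identity.

module _ (G : SimpleGraph) where
  open SimpleGraph G
  open Finite finite using (unique; complete)

  -- These edges are the inserted neighbours of `v` in `R G`, hence the doubling of old degrees;
  -- they also give the row totals in `handshake`.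
  count-incident-edges : ∀ v → count (v endOf?_) (allFin size) ≡ degree v
  count-incident-edges v = begin
    count (v endOf?_) (allFin size)
      ≡⟨ count-allFin-lookup (incident? _≟_ _~?_ v) edges ⟩
    count (incident? _≟_ _~?_ v) edges
      ≡⟨ count-filter (λ e → proj₁ e ~? proj₂ e) (incident? _≟_ _~?_ v) (pairs vertices) ⟩
    count (edgeAt? _≟_ _~?_ v) (pairs vertices)
      ≡⟨ count-edgeAt _≟_ _~?_ ~-sym ~-irrefl unique (complete v) ⟩
    degree v ∎

  -- The two ends are distinct because the pair passed the adjacency filter and adjacency is
  -- irreflexive; each of them is listed once in `vertices`.
  count-ends : ∀ e → count (_endOf? e) vertices ≡ 2
  count-ends e = trans
    (count-disjoint (_≟ proj₁ (lookup edges e)) (_≟ proj₂ (lookup edges e)) distinct vertices)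
    (cong₂ _+_ (count-unique _≟_ unique (complete _)) (count-unique _≟_ unique (complete _)))
    where
    adjacent : proj₁ (lookup edges e) ~ proj₂ (lookup edges e)
    adjacent = All.lookup (all-filter (λ e → proj₁ e ~? proj₂ e) (pairs vertices)) (∈-lookup e)

    distinct : ∀ {v} → v ≡ proj₁ (lookup edges e) → ¬ (v ≡ proj₂ (lookup edges e))
    distinct v≡p v≡q =
      ~-irrefl (subst (proj₁ (lookup edges e) ~_) (trans (sym v≡q) v≡p) adjacent)

  length-allFin : length (allFin size) ≡ size
  length-allFin = length-tabulate id

  -- Double counting of incidences: a vertex lies on as many edges as its degree, and an edge has
  -- two ends.
  handshake : sum (map degree vertices) ≡ 2 * size
  handshake = begin
    sum (map degree vertices)
      ≡⟨ cong sum (map-cong count-incident-edges vertices) ⟨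
    sum (map (λ v → count (v endOf?_) (allFin size)) vertices)
      ≡⟨ double-count _endOf?_ vertices (allFin size) ⟩
    sum (map (λ e → count (_endOf? e) vertices) (allFin size))
      ≡⟨ cong sum (map-cong count-ends (allFin size)) ⟩
    sum (map (λ _ → 2) (allFin size))
      ≡⟨ sum-const 2 (allFin size) ⟩
    length (allFin size) * 2
      ≡⟨ cong (_* 2) length-allFin ⟩
    size * 2
      ≡⟨ *-comm size 2 ⟩
    2 * size ∎

-- Degrees and the F-index of the join.

module _ (G₁ G₂ : SimpleGraph) where
  private
    module G₁ = SimpleGraph G₁
    module G₂ = SimpleGraph G₂
    module H  = SimpleGraph (R G₁)
    module J  = SimpleGraph (G₁ ∨ᴿ G₂)

  degree-∨ᴿ-old : ∀ u → J.degree (inj₁ (inj₁ u)) ≡ 2 * G₁.degree u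
  degree-∨ᴿ-old u = begin
    J.degree (inj₁ (inj₁ u))
      ≡⟨ count-⊎ (inj₁ (inj₁ u) J.~?_) H.vertices G₂.vertices ⟩
    H.degree (inj₁ u) + count (λ w → inj₁ (inj₁ u) J.~? inj₂ w) G₂.vertices
      ≡⟨ cong₂ _+_ (count-⊎ (inj₁ u H.~?_) G₁.vertices (allFin G₁.size))
           -- Only inserted vertices are joined to `G₂`, so an old vertex gains nothing there.
           (count-none (λ w → inj₁ (inj₁ u) J.~? inj₂ w) (All.universal (λ _ ()) G₂.vertices)) ⟩
    G₁.degree u + count (u G₁.endOf?_) (allFin G₁.size) + 0
      ≡⟨ cong (λ k → G₁.degree u + k + 0) (count-incident-edges G₁ u) ⟩
    G₁.degree u + G₁.degree u + 0
      ≡⟨ solve 1 (λ d → d :+ d :+ con 0 := con 2 :* d) refl (G₁.degree u) ⟩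
    2 * G₁.degree u ∎

  -- The 2 comes from the ends of `e` and the rest from all of `G₂`; inserted vertices are pairwise
  -- nonadjacent.
  degree-∨ᴿ-inserted : ∀ e → J.degree (inj₁ (inj₂ e)) ≡ G₂.order + 2
  degree-∨ᴿ-inserted e = begin
    J.degree (inj₁ (inj₂ e))
      ≡⟨ count-⊎ (inj₁ (inj₂ e) J.~?_) H.vertices G₂.vertices ⟩
    H.degree (inj₂ e) + count (λ w → inj₁ (inj₂ e) J.~? inj₂ w) G₂.vertices
      ≡⟨ cong₂ _+_ (count-⊎ (inj₂ e H.~?_) G₁.vertices (allFin G₁.size))
           (count-all (λ w → inj₁ (inj₂ e) J.~? inj₂ w) (λ _ → tt) G₂.vertices) ⟩
    count (G₁._endOf? e) G₁.vertices + count (λ f → inj₂ e H.~? inj₂ f) (allFin G₁.size)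
      + G₂.order
      ≡⟨ cong₂ (λ k l → k + l + G₂.order) (count-ends G₁ e)
           (count-none (λ f → inj₂ e H.~? inj₂ f) (All.universal (λ _ ()) (allFin G₁.size))) ⟩
    2 + G₂.order
      ≡⟨ +-comm 2 G₂.order ⟩
    G₂.order + 2 ∎

  -- Within `R G₁`, the vertex `w` sees no old vertex and every inserted one, of which there is one
  -- per edge.
  degree-∨ᴿ-right : ∀ w → J.degree (inj₂ w) ≡ G₁.size + G₂.degree w
  degree-∨ᴿ-right w = begin
    J.degree (inj₂ w)
      ≡⟨ count-⊎ (inj₂ w J.~?_) H.vertices G₂.vertices ⟩
    count (λ x → inj₂ w J.~? inj₁ x) H.vertices + G₂.degree w
      ≡⟨ cong (_+ G₂.degree w)
           (count-⊎ (λ x → inj₂ w J.~? inj₁ x) G₁.vertices (allFin G₁.size)) ⟩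
    count (λ u → inj₂ w J.~? inj₁ (inj₁ u)) G₁.vertices
      + count (λ e → inj₂ w J.~? inj₁ (inj₂ e)) (allFin G₁.size) + G₂.degree w
      ≡⟨ cong₂ (λ k l → k + l + G₂.degree w)
           (count-none (λ u → inj₂ w J.~? inj₁ (inj₁ u)) (All.universal (λ _ ()) G₁.vertices))
           (trans (count-all (λ e → inj₂ w J.~? inj₁ (inj₂ e)) (λ _ → tt) (allFin G₁.size))
                  (length-allFin G₁)) ⟩
    G₁.size + G₂.degree w ∎

  -- The vertex list is a concatenation of old, inserted and right-hand vertices, with one degree
  -- formula for each block. The last sum is left unexpanded, since simplifying it takes the
  -- handshake identity of `G₂`.
  F-∨ᴿ-split : F (G₁ ∨ᴿ G₂) ≡
    8 * F G₁ + G₁.size * (G₂.order + 2) ^ 3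
      + sum (map (λ w → (G₁.size + G₂.degree w) ^ 3) G₂.vertices)
  F-∨ᴿ-split = begin
    F (G₁ ∨ᴿ G₂)
      ≡⟨ sum-⊎ (λ x → J.degree x ^ 3) H.vertices G₂.vertices ⟩
    sum (map (λ x → J.degree (inj₁ x) ^ 3) H.vertices) + right
      ≡⟨ cong (_+ right) (sum-⊎ (λ x → J.degree (inj₁ x) ^ 3) G₁.vertices (allFin G₁.size)) ⟩
    sum (map (λ u → J.degree (inj₁ (inj₁ u)) ^ 3) G₁.vertices)
      + sum (map (λ e → J.degree (inj₁ (inj₂ e)) ^ 3) (allFin G₁.size)) + right
      ≡⟨ cong₂ _+_ (cong₂ _+_ old inserted)
           (cong sum (map-cong (λ w → cong (_^ 3) (degree-∨ᴿ-right w)) G₂.vertices)) ⟩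
    8 * F G₁ + G₁.size * (G₂.order + 2) ^ 3
      + sum (map (λ w → (G₁.size + G₂.degree w) ^ 3) G₂.vertices) ∎
    where
    right : ℕ
    right = sum (map (λ w → J.degree (inj₂ w) ^ 3) G₂.vertices)

    old : sum (map (λ u → J.degree (inj₁ (inj₁ u)) ^ 3) G₁.vertices) ≡ 8 * F G₁
    old = trans (cong sum (map-cong (λ u → cong (_^ 3) (degree-∨ᴿ-old u)) G₁.vertices))
                (sum-double-cube G₁.degree G₁.vertices)

    inserted : sum (map (λ e → J.degree (inj₁ (inj₂ e)) ^ 3) (allFin G₁.size)) ≡
               G₁.size * (G₂.order + 2) ^ 3
    inserted = begin
      sum (map (λ e → J.degree (inj₁ (inj₂ e)) ^ 3) (allFin G₁.size))
        ≡⟨ cong sum (map-cong (λ e → cong (_^ 3) (degree-∨ᴿ-inserted e)) (allFin G₁.size)) ⟩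
      sum (map (λ _ → (G₂.order + 2) ^ 3) (allFin G₁.size))
        ≡⟨ sum-const ((G₂.order + 2) ^ 3) (allFin G₁.size) ⟩
      length (allFin G₁.size) * (G₂.order + 2) ^ 3
        ≡⟨ cong (_* (G₂.order + 2) ^ 3) (length-allFin G₁) ⟩
      G₁.size * (G₂.order + 2) ^ 3 ∎

theorem4 : (G₁ G₂ : SimpleGraph) →
    SimpleGraph.Connected G₁ → SimpleGraph.Connected G₂ →
    (n₁ n₂ m₁ m₂ : ℕ) →
    SimpleGraph.order G₁ ≡ n₁ → SimpleGraph.order G₂ ≡ n₂ →
    SimpleGraph.size G₁ ≡ m₁ → SimpleGraph.size G₂ ≡ m₂ →
    F (G₁ ∨ᴿ G₂) ≡
    8 * F G₁ + F G₂ + 3 * m₁ * M₁ G₂ + 6 * m₁ ^ 2 * m₂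
    + m₁ * (n₂ + 2) ^ 3 + n₂ * m₁ ^ 3
theorem4 G₁ G₂ _ _ _ n₂ m₁ m₂ refl refl refl refl = begin
  F (G₁ ∨ᴿ G₂)
    ≡⟨ F-∨ᴿ-split G₁ G₂ ⟩
  8 * F G₁ + m₁ * (n₂ + 2) ^ 3 + sum (map (λ w → (m₁ + G₂.degree w) ^ 3) G₂.vertices)
    -- The sums of cubed and squared degrees in the expansion are `F G₂` and `M₁ G₂` by definition.
    ≡⟨ cong (8 * F G₁ + m₁ * (n₂ + 2) ^ 3 +_)
         (sum-shifted-cube m₁ G₂.degree G₂.vertices) ⟩
  8 * F G₁ + m₁ * (n₂ + 2) ^ 3
    + (F G₂ + 3 * m₁ * M₁ G₂ + 3 * m₁ ^ 2 * sum (map G₂.degree G₂.vertices) + n₂ * m₁ ^ 3)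
    -- The degree sum `2 * m₂` turns the binomial coefficient 3 into the 6 of the claim.
    ≡⟨ cong (λ s → 8 * F G₁ + m₁ * (n₂ + 2) ^ 3
                     + (F G₂ + 3 * m₁ * M₁ G₂ + 3 * m₁ ^ 2 * s + n₂ * m₁ ^ 3))
         (handshake G₂) ⟩
  8 * F G₁ + m₁ * (n₂ + 2) ^ 3
    + (F G₂ + 3 * m₁ * M₁ G₂ + 3 * m₁ ^ 2 * (2 * m₂) + n₂ * m₁ ^ 3)
    ≡⟨ solve 6 (λ f₁ f₂ q m k n →
           con 8 :* f₁ :+ m :* (n :+ con 2) :^ 3
             :+ (f₂ :+ con 3 :* m :* q :+ con 3 :* m :^ 2 :* (con 2 :* k) :+ n :* m :^ 3)
           := con 8 :* f₁ :+ f₂ :+ con 3 :* m :* q :+ con 6 :* m :^ 2 :* k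
             :+ m :* (n :+ con 2) :^ 3 :+ n :* m :^ 3) refl
         (F G₁) (F G₂) (M₁ G₂) m₁ m₂ n₂ ⟩
  8 * F G₁ + F G₂ + 3 * m₁ * M₁ G₂ + 6 * m₁ ^ 2 * m₂
    + m₁ * (n₂ + 2) ^ 3 + n₂ * m₁ ^ 3 ∎
  where
  module G₂ = SimpleGraph G₂
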